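{- Let $F(n)$ be the Fibonacci sequence, $F(0)=0$, $F(1)=1$, $F(n+2)=F(n+1)+F(n)$. Then $$\lim_{\alpha\to\infty}\frac{|\{F(n)\bmod 11^\alpha:n\ge0\}|}{11^\alpha}=\frac{145}{264}.$$ -}

module Defs where

open import Data.Fin.Base using (Fin)
open import Data.Fin.Subset using (Subset; _∈_; ∣_∣)
open import Data.Integer.Base using (+_)
open import Data.Nat.Base using (ℕ; zero; suc; _+_; _≥_; NonZero)
open import Data.Nat.DivMod using (_mod_)
open import Data.Product.Base using (∃-syntax)
open import Data.Rational.Base as ℚ using (ℚ; 0ℚ)
open import Function.Bundles using (_⇔_)
open import Relation.Binary.PropositionalEquality.Core using (_≡_)

F : ℕ → ℕ
F zero          = 0
F (suc zero)    = 1
F (suc (suc n)) = F (suc n) + F n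

-- S = { s n mod m : n ≥ 0 }, with Fin m representing the residues modulo m.
-- A Subset is determined by its members, so S, hence ∣ S ∣, is unique.
IsResidueSet : (s : ℕ → ℕ) (m : ℕ) .{{_ : NonZero m}} → Subset m → Set
IsResidueSet s m S = ∀ (r : Fin m) → r ∈ S ⇔ (∃[ n ] s n mod m ≡ r)

density : (m : ℕ) .{{_ : NonZero m}} → Subset m → ℚ
density m S = + ∣ S ∣ ℚ./ m

-- For rational a and L, letting ε range over rationals is equivalent to
-- letting it range over reals.
Limit : (ℕ → ℚ) → ℚ → Set
Limit a L = ∀ (ε : ℚ) → 0ℚ ℚ.< ε →
  ∃[ N ] (∀ n → n ≥ N → ℚ.∣ a n ℚ.- L ∣ ℚ.< ε)

{-# OPTIONS --safe #-}
module Submission where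

open import Data.Bool.Base using (Bool; true; false; if_then_else_)
import Data.Bool.Properties as Bool
open import Data.Fin.Base as Fin using (Fin; toℕ; fromℕ<)
open import Data.Fin.Properties using (all?; toℕ-fromℕ<; toℕ-injective; toℕ<n)
open import Data.Fin.Subset using (Subset; ∣_∣; _∈_)
open import Data.Integer.Base as ℤ using (ℤ; +_; -[1+_]; _+_; _*_; _-_; -_; 0ℤ; 1ℤ; _%ℕ_; _/ℕ_; +<+)
open import Data.Integer.DivMod using (a≡a%ℕn+[a/ℕn]*n; n%ℕd<d)
import Data.Integer.Properties as ℤ
open import Data.Integer.Tactic.RingSolver using (solve-∀)
open import Data.Nat.Base as ℕ using (ℕ; zero; suc; _^_; NonZero)
open import Data.Nat.Divisibility using (divides-refl)
import Data.Nat.DivMod as ℕ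
import Data.Nat.Properties as ℕ
open import Data.Nat.Properties using (m^n≢0)
import Data.Nat.Tactic.RingSolver as ℕ
open import Data.Product.Base using (Σ-syntax; ∃-syntax; _×_; _,_; proj₁; proj₂)
open import Data.Rational.Base as ℚ using (mkℚ; toℚᵘ; positive; 0ℚ; _/_)
import Data.Rational.Properties as ℚ
open import Data.Rational.Unnormalised.Base as ℚᵘ using (mkℚᵘ; *<*)
import Data.Rational.Unnormalised.Properties as ℚᵘ
open import Data.Sum.Base using (_⊎_; inj₁; inj₂; [_,_]′)
open import Data.Vec.Base using (tabulate)
open import Data.Vec.Properties using (lookup∘tabulate; []=⇒lookup; lookup⇒[]=)
open import Function.Base using (_∘_; _$_)
open import Function.Bundles using (_⇔_; mk⇔; module Equivalence)
open import Relation.Binary.PropositionalEquality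
open import Relation.Nullary.Decidable using (from-yes; _→-dec_; _⊎-dec_)
open import Relation.Nullary.Negation using (contradiction)
open import Defs

-- Modulo 11 the Fibonacci sequence has period 10, and φ^(10·11^α) = 1 + 11^(α+1) ε with ε
-- constant modulo 11.  Hence k ↦ F (i + 10 k) can be lifted à la Hensel to all of
-- F i + 11 ℤ₁₁ unless 11 divides the Lucas number L i, which happens only for i = 5.
-- The other i contribute the six residues 0, 1, 2, 3, 8, 10 modulo 11 entirely.
-- For n ≡ 5 mod 10 one has L n ^ 2 = 5 (F n)^2 − 4, and L itself lifts to all of 11 ℤ₁₁.
-- So with C ≡ 5 mod 11 the zero of 5 x² − 4, the value x = C + y is attained iff
-- 5 y (y + 2 C) is a square; as 5 (y + 2 C) ≡ 6 is a non-residue, this means that y is 0 or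
-- has even valuation and non-residue leading digit.  These y, restricted to 11 ∣ y, have
-- density 5/11 · (11⁻² + 11⁻⁴ + …) = 1/264, and 6/11 + 1/264 = 145/264.

-- Congruences of integers

infix 4 _≈_[mod_]

-- The quotient is explicit data: matching on `by q refl` turns each congruence rule into a
-- polynomial identity.
record _≈_[mod_] (a b m : ℤ) : Set where
  constructor by
  field
    quotient : ℤ
    equality : a ≡ b + quotient * m

≈-reflexive : ∀ {a b m} → a ≡ b → a ≈ b [mod m ]
≈-reflexive {a} {m = m} refl = by 0ℤ (lemma a m)
  where
  lemma : ∀ a m → a ≡ a + 0ℤ * m
  lemma = solve-∀

≈-refl : ∀ {a m} → a ≈ a [mod m ]
≈-refl = ≈-reflexive refl

≈-sym : ∀ {a b m} → a ≈ b [mod m ] → b ≈ a [mod m ]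
≈-sym {b = b} {m} (by q e) = by (- q) (trans (lemma b q m) (cong (_+ - q * m) (sym e)))
  where
  lemma : ∀ b q m → b ≡ b + q * m + - q * m
  lemma = solve-∀

infixr 2 _⟫_
_⟫_ : ∀ {a b c m} → a ≈ b [mod m ] → b ≈ c [mod m ] → a ≈ c [mod m ]
_⟫_ {c = c} {m} (by q refl) (by r refl) = by (q + r) (lemma c q r m)
  where
  lemma : ∀ c q r m → c + r * m + q * m ≡ c + (q + r) * m
  lemma = solve-∀

+-cong-≈ : ∀ {a b c d m} → a ≈ b [mod m ] → c ≈ d [mod m ] → a + c ≈ b + d [mod m ]
+-cong-≈ {b = b} {d = d} {m} (by q refl) (by r refl) = by (q + r) (lemma b d q r m)
  where
  lemma : ∀ b d q r m → b + q * m + (d + r * m) ≡ b + d + (q + r) * m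
  lemma = solve-∀

*-cong-≈ : ∀ {a b c d m} → a ≈ b [mod m ] → c ≈ d [mod m ] → a * c ≈ b * d [mod m ]
*-cong-≈ {b = b} {d = d} {m} (by q refl) (by r refl) =
  by (q * d + b * r + q * r * m) (lemma b d q r m)
  where
  lemma : ∀ b d q r m →
    (b + q * m) * (d + r * m) ≡ b * d + (q * d + b * r + q * r * m) * m
  lemma = solve-∀

neg-cong-≈ : ∀ {a b m} → a ≈ b [mod m ] → - a ≈ - b [mod m ]
neg-cong-≈ {b = b} {m} (by q refl) = by (- q) (lemma b q m)
  where
  lemma : ∀ b q m → - (b + q * m) ≡ - b + - q * m
  lemma = solve-∀

+-congˡ-≈ : ∀ {m c d} a → c ≈ d [mod m ] → a + c ≈ a + d [mod m ]
+-congˡ-≈ a = +-cong-≈ (≈-refl {a})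

*-congˡ-≈ : ∀ {m c d} a → c ≈ d [mod m ] → a * c ≈ a * d [mod m ]
*-congˡ-≈ a = *-cong-≈ (≈-refl {a})

≈-difference : ∀ {a b m} → a - b ≈ 0ℤ [mod m ] → a ≈ b [mod m ]
≈-difference {a} {b} {m} (by q e) =
  by q (trans (lemma₁ a b) (trans (cong (_+ b) e) (lemma₂ b q m)))
  where
  lemma₁ : ∀ a b → a ≡ a - b + b
  lemma₁ = solve-∀
  lemma₂ : ∀ b q m → 0ℤ + q * m + b ≡ b + q * m
  lemma₂ = solve-∀

≈-modulus : ∀ {a b m n} → m ≡ n → a ≈ b [mod m ] → a ≈ b [mod n ]
≈-modulus refl a≈b = a≈b

≈-weaken : ∀ k {a b m} → a ≈ b [mod k * m ] → a ≈ b [mod m ]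
≈-weaken k {b = b} {m} (by q refl) = by (q * k) (cong (λ w → b + w) (sym (ℤ.*-assoc q k m)))

≈-scale : ∀ k {a b m} → a ≈ b [mod m ] → k * a ≈ k * b [mod k * m ]
≈-scale k {b = b} {m} (by q refl) = by q (lemma k b q m)
  where
  lemma : ∀ k b q m → k * (b + q * m) ≡ k * b + q * (k * m)
  lemma = solve-∀

≈-unscale : ∀ k .{{_ : NonZero k}} {a b m} → + k * a ≈ + k * b [mod + k * m ] → a ≈ b [mod m ]
≈-unscale (suc k) {a} {b} {m} (by q e) =
  by q (ℤ.*-cancelˡ-≡ (+ suc k) a _ (trans e (lemma (+ suc k) b q m)))
  where
  lemma : ∀ k b q m → k * b + q * (k * m) ≡ k * (b + q * m)
  lemma = solve-∀

remainder : ∀ z m .{{_ : NonZero m}} → z ≈ + (z %ℕ m) [mod + m ]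
remainder z m = by (z /ℕ m) (a≡a%ℕn+[a/ℕn]*n z m)

remainderℕ : ∀ n m .{{_ : NonZero m}} → + n ≈ + (n ℕ.% m) [mod + m ]
remainderℕ n m = remainder (+ n) m

≈⇒%≡ : ∀ m .{{_ : NonZero m}} {a b} → + a ≈ + b [mod + m ] → a ℕ.% m ≡ b ℕ.% m
≈⇒%≡ m {a} {b} (by (+ q) e) =
  trans (cong (ℕ._% m) (ℤ.+-injective (trans e (cong (λ z → + b + z) (sym (ℤ.pos-* q m))))))
        (ℕ.[m+kn]%n≡m%n b q m)
-- A negative quotient is moved to the other side, where it becomes a natural multiple of `m`.
≈⇒%≡ m {a} {b} a≈b@(by -[1+ q ] e) = sym
  (trans (cong (ℕ._% m) (ℤ.+-injective (trans (_≈_[mod_].equality (≈-sym a≈b))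
                                             (cong (λ z → + a + z) (sym (ℤ.pos-* (suc q) m))))))
         (ℕ.[m+kn]%n≡m%n a (suc q) m))

P : ℕ → ℤ
P α = + (11 ^ α)

P-suc : ∀ α → P (suc α) ≡ + 11 * P α
P-suc α = ℤ.pos-* 11 (11 ^ α)

mod-P-suc : ∀ α {a b} → a ≈ b [mod + 11 * P α ] → a ≈ b [mod P (suc α) ]
mod-P-suc α = ≈-modulus (sym (P-suc α))

mod-P-suc⁻ : ∀ α {a b} → a ≈ b [mod P (suc α) ] → a ≈ b [mod + 11 * P α ]
mod-P-suc⁻ α = ≈-modulus (P-suc α)

mod-11 : ∀ α {a b} → a ≈ b [mod P (suc α) ] → a ≈ b [mod + 11 ]
mod-11 α = ≈-weaken (P α) ∘ ≈-modulus (trans (P-suc α) (ℤ.*-comm (+ 11) (P α)))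

-- Write v c = 1 + 11 t, so z = v (c z) - 11 t z. By induction 11^α divides z, hence 11^(α+1)
-- divides both terms. An inverse of `c` modulo 11 thus serves every power of 11.
unit-cancel : ∀ c v → v * c ≈ 1ℤ [mod + 11 ] → ∀ α {z} →
  c * z ≈ 0ℤ [mod P α ] → z ≈ 0ℤ [mod P α ]
unit-cancel c v (by t vc≡1+11t) zero {z} _ = by z (lemma z)
  where
  lemma : ∀ z → z ≡ 0ℤ + z * 1ℤ
  lemma = solve-∀
unit-cancel c v (by t vc≡1+11t) (suc α) {z} (by q cz≡)
  with by y z≡ ← unit-cancel c v (by t vc≡1+11t) α {z}
         (≈-weaken (+ 11) (mod-P-suc⁻ α (by q cz≡)))
  = by (v * q - t * y) $ begin
      z                                             ≡⟨ lemma₁ t z ⟩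
      (1ℤ + t * + 11) * z - + 11 * t * z            ≡⟨ cong₂ (λ u w → u * z - + 11 * t * w) (sym vc≡1+11t) z≡ ⟩
      v * c * z - + 11 * t * (0ℤ + y * P α)         ≡⟨ cong (_- + 11 * t * (0ℤ + y * P α)) (ℤ.*-assoc v c z) ⟩
      v * (c * z) - + 11 * t * (0ℤ + y * P α)
        ≡⟨ cong (λ w → v * w - + 11 * t * (0ℤ + y * P α))
             (trans cz≡ (cong (λ w → 0ℤ + q * w) (P-suc α))) ⟩
      v * (0ℤ + q * (+ 11 * P α)) - + 11 * t * (0ℤ + y * P α) ≡⟨ lemma₂ v q t y (P α) ⟩
      0ℤ + (v * q - t * y) * (+ 11 * P α)           ≡⟨ cong (λ w → 0ℤ + (v * q - t * y) * w) (P-suc α) ⟨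
      0ℤ + (v * q - t * y) * P (suc α)              ∎
  where
  open ≡-Reasoning
  lemma₁ : ∀ t z → z ≡ (1ℤ + t * + 11) * z - + 11 * t * z
  lemma₁ = solve-∀
  lemma₂ : ∀ v q t y p →
    v * (0ℤ + q * (+ 11 * p)) - + 11 * t * (0ℤ + y * p) ≡ 0ℤ + (v * q - t * y) * (+ 11 * p)
  lemma₂ = solve-∀

-- Fibonacci-like sequences modulo powers of 11

fib : ℕ → ℤ
fib n = + F n

-- The Lucas numbers: F (n-1) + F (n+1), rewritten to avoid the predecessor.
luc : ℕ → ℤ
luc n = + 2 * fib (suc n) - fib n

FibonacciLike : (ℕ → ℤ) → Set
FibonacciLike g = ∀ n → g (suc (suc n)) ≡ g (suc n) + g n

fib-like : FibonacciLike fib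
fib-like n = refl

luc-like : FibonacciLike luc
luc-like n = lemma (fib (suc n)) (fib n)
  where
  lemma : ∀ u v → + 2 * (u + v + u) - (u + v) ≡ (+ 2 * (u + v) - u) + (+ 2 * u - v)
  lemma = solve-∀

-- The addition formula, with F (N-1) written as F (N+1) - F N. The induction moves one step from
-- `N` to `n`.
shift-formula : ∀ g → FibonacciLike g → ∀ N n →
  g (N ℕ.+ n) ≡ g n * (fib (suc N) - fib N) + g (suc n) * fib N
shift-formula g rec zero n = lemma (g n) (g (suc n))
  where
  lemma : ∀ u v → u ≡ u * (1ℤ - 0ℤ) + v * 0ℤ
  lemma = solve-∀
shift-formula g rec (suc N) n = begin
  g (suc N ℕ.+ n)   ≡⟨ cong g (ℕ.+-suc N n) ⟨
  g (N ℕ.+ suc n)   ≡⟨ shift-formula g rec N (suc n) ⟩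
  g (suc n) * (fib (suc N) - fib N) + g (suc (suc n)) * fib N
    ≡⟨ cong (λ w → g (suc n) * (fib (suc N) - fib N) + w * fib N) (rec n) ⟩
  g (suc n) * (fib (suc N) - fib N) + (g (suc n) + g n) * fib N
    ≡⟨ lemma (g n) (g (suc n)) (fib N) (fib (suc N)) ⟩
  g n * (fib (suc N) + fib N - fib (suc N)) + g (suc n) * fib (suc N) ∎
  where
  open ≡-Reasoning
  lemma : ∀ u v s t → v * (t - s) + (v + u) * s ≡ u * (t + s - t) + v * t
  lemma = solve-∀

-- N is a period modulo x, with first-order terms a and b known modulo 11.
record Period (N : ℕ) (x : ℤ) : Set where
  field
    a b    : ℤ
    fib-N  : fib N ≡ x * a
    fib-1+N : fib (suc N) ≡ 1ℤ + x * b
    a≈5    : a ≈ + 5 [mod + 11 ]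
    b≈8    : b ≈ + 8 [mod + 11 ]

  slope : (ℕ → ℤ) → ℕ → ℤ
  slope g n = g n * (b - a) + g (suc n) * a

  -- The shift by `N` is an operator 1 + x E with E g = `slope g`, and (1 + x E)^k ≡ 1 + k x E
  -- modulo x². Since E involves two consecutive values, the induction uses its hypothesis at `n`
  -- and at `suc n`.
  linearise : ∀ g → FibonacciLike g → ∀ k n →
    g (k ℕ.* N ℕ.+ n) ≈ g n + + k * x * slope g n [mod x * x ]
  linearise g rec zero n = by 0ℤ (lemma (g n) x (slope g n))
    where
    lemma : ∀ u x s → u ≡ u + 0ℤ * x * s + 0ℤ * (x * x)
    lemma = solve-∀
  linearise g rec (suc k) n
    with by s es ← linearise g rec k n
    with by t et ← linearise g rec k (suc n)
    = by (+ k * slope g n * (b - a) + s * (1ℤ + x * b - x * a)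
          + + k * (g (suc n) * (b - a) + (g (suc n) + g n) * a) * a + t * (x * a)) $ begin
    g (suc k ℕ.* N ℕ.+ n)     ≡⟨ cong g (ℕ.+-assoc N (k ℕ.* N) n) ⟩
    g (N ℕ.+ (k ℕ.* N ℕ.+ n)) ≡⟨ shift-formula g rec N (k ℕ.* N ℕ.+ n) ⟩
    g (k ℕ.* N ℕ.+ n) * (fib (suc N) - fib N) + g (suc (k ℕ.* N ℕ.+ n)) * fib N
      ≡⟨ cong₂ (λ v w → g (k ℕ.* N ℕ.+ n) * (v - w) + g (suc (k ℕ.* N ℕ.+ n)) * w) fib-1+N fib-N ⟩
    g (k ℕ.* N ℕ.+ n) * (1ℤ + x * b - x * a) + g (suc (k ℕ.* N ℕ.+ n)) * (x * a)
      ≡⟨ cong₂ (λ v w → v * (1ℤ + x * b - x * a) + w * (x * a)) es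
           (trans (cong g (sym (ℕ.+-suc (k ℕ.* N) n)))
                  (trans et (cong (λ w → g (suc n) + + k * x * (g (suc n) * (b - a) + w * a) + t * (x * x)) (rec n)))) ⟩
    _ ≡⟨ lemma (g n) (g (suc n)) x a b (+ k) s t ⟩
    _ ∎
    where
    open ≡-Reasoning
    lemma : ∀ u v x a b k s t →
      (u + k * x * (u * (b - a) + v * a) + s * (x * x)) * (1ℤ + x * b - x * a)
        + (v + k * x * (v * (b - a) + (v + u) * a) + t * (x * x)) * (x * a)
      ≡ u + (1ℤ + k) * x * (u * (b - a) + v * a)
        + (k * (u * (b - a) + v * a) * (b - a) + s * (1ℤ + x * b - x * a)
           + k * (v * (b - a) + (v + u) * a) * a + t * (x * a)) * (x * x)
    lemma = solve-∀

fibFrom : ℕ → ℕ → ℕ → ℕ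
fibFrom zero    u v = u
fibFrom (suc n) u v = fibFrom n v (v ℕ.+ u)

fibFrom-correct : ∀ n m → fibFrom n (F m) (F (suc m)) ≡ F (n ℕ.+ m)
fibFrom-correct zero    m = refl
fibFrom-correct (suc n) m = trans (fibFrom-correct n (suc m)) (cong F (ℕ.+-suc n m))

-- Evaluating F directly takes exponential time.
F≡fibFrom : ∀ n → F n ≡ fibFrom n 0 1
F≡fibFrom n = trans (cong F (sym (ℕ.+-identityʳ n))) (sym (fibFrom-correct n 0))

period-10 : Period 10 (+ 11)
period-10 = record
  { a = + 5 ; b = + 8 ; fib-N = refl ; fib-1+N = refl ; a≈5 = ≈-refl ; b≈8 = ≈-refl }

fibFrom-110 : fibFrom 110 0 1 ≡ 43566776258854844738105
fibFrom-110 = refl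

fibFrom-111 : fibFrom 111 0 1 ≡ 70492524767089125814114
fibFrom-111 = refl

-- `N` is a variable so that `fib N` does not unfold; its value is reached through `fibFrom` only.
period-110 : ∀ N → N ≡ 110 → Period N (+ 121)
period-110 N N≡110 = record
  -- These are F 110 / 121 and (F 111 - 1) / 121.
  { a = + 360056002139296237505
  ; b = + 582582849314786163753
  ; fib-N = cong +_ (trans (F≡fibFrom N) (trans (cong (λ n → fibFrom n 0 1) N≡110) fibFrom-110))
  ; fib-1+N = cong +_ (trans (F≡fibFrom (suc N)) (trans (cong (λ n → fibFrom (suc n) 0 1) N≡110) fibFrom-111))
  ; a≈5 = remainder (+ 360056002139296237505) 11
  ; b≈8 = remainder (+ 582582849314786163753) 11
  }

-- For x = 11^(α+1) the quadratic error x² is a multiple of the next modulus 11 x, as both Hensel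
-- liftings require.
P-square : ∀ α → P (suc α) * P (suc α) ≡ P α * (+ 11 * P (suc α))
P-square α = trans (cong (_* P (suc α)) (P-suc α)) (lemma (P α) (P (suc α)))
  where
  lemma : ∀ p q → + 11 * p * q ≡ p * (+ 11 * q)
  lemma = solve-∀

-- The second-order error x² is divisible by 11 · 11 x only from x = 11² on.
period-multiple : ∀ {N x p} k → x * x ≡ p * + 11 * (+ k * x) →
  Period N x → Period (k ℕ.* N) (+ k * x)
period-multiple {N} {x} {p} k x² per
  with by s es ← Period.linearise per fib fib-like k 0
  with by t et ← Period.linearise per fib fib-like k 1
  = record
  { a = a + + 11 * (s * p)
  ; b = b + + 11 * (t * p)
  ; fib-N = begin
      fib (k ℕ.* N)                            ≡⟨ cong fib (ℕ.+-identityʳ (k ℕ.* N)) ⟨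
      fib (k ℕ.* N ℕ.+ 0)                      ≡⟨ es ⟩
      fib 0 + + k * x * (fib 0 * (b - a) + fib 1 * a) + s * (x * x)
        ≡⟨ cong (λ w → fib 0 + + k * x * (fib 0 * (b - a) + fib 1 * a) + s * w) x² ⟩
      fib 0 + + k * x * (fib 0 * (b - a) + fib 1 * a) + s * (p * + 11 * (+ k * x))
        ≡⟨ lemma₁ a b p x s (+ k) ⟩
      + k * x * (a + + 11 * (s * p))           ∎
  ; fib-1+N = begin
      fib (suc (k ℕ.* N))                      ≡⟨ cong fib (ℕ.+-comm 1 (k ℕ.* N)) ⟩
      fib (k ℕ.* N ℕ.+ 1)                      ≡⟨ et ⟩
      fib 1 + + k * x * (fib 1 * (b - a) + fib 2 * a) + t * (x * x)
        ≡⟨ cong (λ w → fib 1 + + k * x * (fib 1 * (b - a) + fib 2 * a) + t * w) x² ⟩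
      fib 1 + + k * x * (fib 1 * (b - a) + fib 2 * a) + t * (p * + 11 * (+ k * x))
        ≡⟨ lemma₂ a b p x t (+ k) ⟩
      1ℤ + + k * x * (b + + 11 * (t * p))      ∎
  ; a≈5 = by (s * p) (cong (λ w → a + w) (ℤ.*-comm (+ 11) (s * p))) ⟫ a≈5
  ; b≈8 = by (t * p) (cong (λ w → b + w) (ℤ.*-comm (+ 11) (t * p))) ⟫ b≈8
  }
  where
  open Period per
  open ≡-Reasoning
  lemma₁ : ∀ a b p x s k →
    0ℤ + k * x * (0ℤ * (b - a) + 1ℤ * a) + s * (p * + 11 * (k * x)) ≡ k * x * (a + + 11 * (s * p))
  lemma₁ = solve-∀
  lemma₂ : ∀ a b p x s k →
    1ℤ + k * x * (1ℤ * (b - a) + 1ℤ * a) + s * (p * + 11 * (k * x)) ≡ 1ℤ + k * x * (b + + 11 * (s * p))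
  lemma₂ = solve-∀

period : ∀ α → Period (11 ^ α ℕ.* 10) (P (suc α))
period zero          = period-10
period (suc zero)    = period-110 (11 ^ 1 ℕ.* 10) refl
period (suc (suc α)) =
  subst₂ Period (sym (ℕ.*-assoc 11 (11 ^ suc α) 10)) (sym (P-suc (2 ℕ.+ α)))
    (period-multiple {p = P α} 11 x² (period (suc α)))
  where
  x² : P (2 ℕ.+ α) * P (2 ℕ.+ α) ≡ P α * + 11 * (+ 11 * P (2 ℕ.+ α))
  x² = trans (P-square (suc α)) (cong (_* (+ 11 * P (2 ℕ.+ α))) (trans (P-suc α) (ℤ.*-comm (+ 11) (P α))))

≈0-scale : ∀ {c} x → c ≈ 0ℤ [mod + 11 ] → c * x ≈ 0ℤ [mod + 11 * x ]
≈0-scale x (by q refl) = by q (lemma q x)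
  where
  lemma : ∀ q x → (0ℤ + q * + 11) * x ≡ 0ℤ + q * (+ 11 * x)
  lemma = solve-∀

periodic-mod-11 : ∀ g → FibonacciLike g → ∀ k n → g (k ℕ.* 10 ℕ.+ n) ≈ g n [mod + 11 ]
periodic-mod-11 g rec k n =
  ≈-weaken (+ 11) (Period.linearise period-10 g rec k n)
  ⟫ by (+ k * Period.slope period-10 g n) (lemma (g n) (+ k) (Period.slope period-10 g n))
  where
  lemma : ∀ u k s → u + k * + 11 * s ≡ u + k * s * + 11
  lemma = solve-∀

-- The coefficients are the same at every level α, so one inverse modulo 11 serves all lifting
-- steps. For `fib` the value is 8 L n modulo 11, hence the exceptional index 5; for `luc` it is 7 F
-- n.
slope-mod-11 : ∀ {N x} (per : Period N x) g n →
  Period.slope per g n ≈ + 3 * g n + + 5 * g (suc n) [mod + 11 ]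
slope-mod-11 per g n =
  +-cong-≈ (*-congˡ-≈ (g n) (+-cong-≈ b≈8 (neg-cong-≈ a≈5))) (*-congˡ-≈ (g (suc n)) a≈5)
  ⟫ ≈-reflexive (lemma (g n) (g (suc n)))
  where
  open Period per
  lemma : ∀ u v → u * (+ 8 - + 5) + v * + 5 ≡ + 3 * u + + 5 * v
  lemma = solve-∀

-- Hensel lifting along n ↦ n + 10 · 11^α j, which moves g n by 11^(α+1) j · slope.
surjective : ∀ g → FibonacciLike g → ∀ i v →
  v * (+ 3 * g i + + 5 * g (suc i)) ≈ 1ℤ [mod + 11 ] →
  ∀ {x} → g i ≈ x [mod + 11 ] → ∀ α → ∃[ k ] g (k ℕ.* 10 ℕ.+ i) ≈ x [mod P (suc α) ]
surjective g rec i v unit gi≈x zero = 0 , gi≈x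
surjective g rec i v unit {x} gi≈x (suc α)
  with k , by q gn≡ ← surjective g rec i v unit gi≈x α
  = j ℕ.* 11 ^ α ℕ.+ k , mod-P-suc (suc α)
      ( ≈-reflexive (cong g index)
      ⟫ ≈-weaken (P α) (≈-modulus (P-square α) (linearise g rec j n))
      ⟫ ≈-reflexive (trans (cong (_+ + j * X * w) gn≡) (lemma₁ x q X (+ j) w))
      ⟫ +-congˡ-≈ x (≈0-scale X correction)
      ⟫ ≈-reflexive (ℤ.+-identityʳ x))
  where
  open Period (period α)
  n = k ℕ.* 10 ℕ.+ i
  X = P (suc α)
  w = slope g n
  -- As g n = x + q X, the new digit must satisfy q + j w ≡ 0 modulo 11, where `v` inverts w. It is
  -- reduced to a natural number because it counts periods.
  j = (- (q * v)) %ℕ 11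

  index : (j ℕ.* 11 ^ α ℕ.+ k) ℕ.* 10 ℕ.+ i ≡ j ℕ.* (11 ^ α ℕ.* 10) ℕ.+ n
  index = trans (cong (ℕ._+ i) (ℕ.*-distribʳ-+ 10 (j ℕ.* 11 ^ α) k))
    (trans (ℕ.+-assoc (j ℕ.* 11 ^ α ℕ.* 10) (k ℕ.* 10) i)
           (cong (ℕ._+ n) (ℕ.*-assoc j (11 ^ α) 10)))

  lemma₁ : ∀ x q X j w → x + q * X + j * X * w ≡ x + (q + j * w) * X
  lemma₁ = solve-∀

  lemma₂ : ∀ q v w → q + - (q * v) * w ≡ q + - q * (v * w)
  lemma₂ = solve-∀

  lemma₃ : ∀ q → q + - q * 1ℤ ≡ 0ℤ
  lemma₃ = solve-∀

  vw≈1 : v * w ≈ 1ℤ [mod + 11 ]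
  vw≈1 = *-congˡ-≈ v
    ( slope-mod-11 (period α) g n
    ⟫ +-cong-≈ (*-congˡ-≈ (+ 3) (periodic-mod-11 g rec k i))
        (*-congˡ-≈ (+ 5) (≈-reflexive (cong g (sym (ℕ.+-suc (k ℕ.* 10) i)))
                         ⟫ periodic-mod-11 g rec k (suc i))))
    ⟫ unit

  correction : q + + j * w ≈ 0ℤ [mod + 11 ]
  correction =
    +-congˡ-≈ q (*-cong-≈ (≈-sym (remainder (- (q * v)) 11)) (≈-refl {w}))
    ⟫ ≈-reflexive (lemma₂ q v w)
    ⟫ +-congˡ-≈ q (*-congˡ-≈ (- q) vw≈1)
    ⟫ ≈-reflexive (lemma₃ q)

-- Cassini's expression, the norm form of ℤ[φ]; its value is (-1)^n.
norm : ℕ → ℤ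
norm n = fib (suc n) * fib (suc n) - fib (suc n) * fib n - fib n * fib n

norm-2+ : ∀ n → norm (2 ℕ.+ n) ≡ norm n
norm-2+ n = lemma (fib (suc n)) (fib n)
  where
  lemma : ∀ v u → (v + u + v) * (v + u + v) - (v + u + v) * (v + u) - (v + u) * (v + u)
    ≡ v * v - v * u - u * u
  lemma = solve-∀

norm-singular : ∀ k → norm (k ℕ.* 10 ℕ.+ 5) ≡ -[1+ 0 ]
norm-singular zero    = refl
norm-singular (suc k) =
  trans (norm-2+ (8 ℕ.+ n)) (trans (norm-2+ (6 ℕ.+ n)) (trans (norm-2+ (4 ℕ.+ n))
    (trans (norm-2+ (2 ℕ.+ n)) (trans (norm-2+ n) (norm-singular k)))))
  where n = k ℕ.* 10 ℕ.+ 5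

-- In general L² - 5 F² = 4 · `norm`, and the index k · 10 + 5 is odd.
conic : ∀ k → let n = k ℕ.* 10 ℕ.+ 5 in luc n * luc n ≡ + 5 * (fib n * fib n) - + 4
conic k = trans (lemma (fib (suc n)) (fib n)) (cong (λ w → + 5 * (fib n * fib n) + + 4 * w) (norm-singular k))
  where
  n = k ℕ.* 10 ℕ.+ 5
  lemma : ∀ v u → (+ 2 * v - u) * (+ 2 * v - u) ≡ + 5 * (u * u) + + 4 * (v * v - v * u - u * u)
  lemma = solve-∀

-- At index 5, where `fib` is singular, `luc` is not: L 5 = 11, L 6 = 18, and 3 · 11 + 5 · 18 has
-- inverse 6 modulo 11.
surjective-luc : ∀ {l} → l ≈ 0ℤ [mod + 11 ] → ∀ α → ∃[ k ] luc (k ℕ.* 10 ℕ.+ 5) ≈ l [mod P (suc α) ]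
surjective-luc l≈0 = surjective luc luc-like 5 (+ 6) (by (+ 67) refl) (by (+ 1) refl ⟫ ≈-sym l≈0)

-- Hensel lifting of a square root: with l² = t + q X the correction j X must solve q + 2 l j ≡ 0
-- modulo 11. Carrying l ≡ l₀ along keeps `v` an inverse of 2 l at every level.
sqrt-lift : ∀ {t} l₀ v → v * (+ 2 * l₀) ≈ 1ℤ [mod + 11 ] → l₀ * l₀ ≈ t [mod + 11 ] →
  ∀ α → ∃[ l ] l * l ≈ t [mod P (suc α) ] × l ≈ l₀ [mod + 11 ]
sqrt-lift l₀ v unit l₀²≈t zero = l₀ , l₀²≈t , ≈-refl
sqrt-lift {t} l₀ v unit l₀²≈t (suc α)
  with l , by q l²≡ , l≈l₀ ← sqrt-lift l₀ v unit l₀²≈t α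
  = l + j * X
  , mod-P-suc (suc α)
      ( ≈-reflexive (trans (lemma₁ l j X)
          (cong₂ (λ u w → u + j * (+ 2 * l) * X + j * j * w) l²≡ (P-square α)))
      ⟫ by (j * j * P α) (lemma₂ t q X j l (P α))
      ⟫ +-congˡ-≈ t (≈0-scale X correction)
      ⟫ ≈-reflexive (ℤ.+-identityʳ t))
  , (+-congˡ-≈ l (*-congˡ-≈ j (mod-11 α (by 1ℤ (lemma₄ X)))) ⟫ ≈-reflexive (lemma₅ l j) ⟫ l≈l₀)
  where
  X = P (suc α)
  j = - (q * v)
  lemma₁ : ∀ l j X → (l + j * X) * (l + j * X) ≡ l * l + j * (+ 2 * l) * X + j * j * (X * X)
  lemma₁ = solve-∀
  lemma₂ : ∀ t q X j l p → t + q * X + j * (+ 2 * l) * X + j * j * (p * (+ 11 * X))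
    ≡ t + (q + j * (+ 2 * l)) * X + j * j * p * (+ 11 * X)
  lemma₂ = solve-∀
  lemma₃ : ∀ q v w → q + - (q * v) * w ≡ q + - q * (v * w)
  lemma₃ = solve-∀
  lemma₄ : ∀ X → X ≡ 0ℤ + 1ℤ * X
  lemma₄ = solve-∀
  lemma₅ : ∀ l j → l + j * 0ℤ ≡ l
  lemma₅ = solve-∀
  lemma₆ : ∀ q → q + - q * 1ℤ ≡ 0ℤ
  lemma₆ = solve-∀

  correction : q + j * (+ 2 * l) ≈ 0ℤ [mod + 11 ]
  correction =
    ≈-reflexive (lemma₃ q v (+ 2 * l))
    ⟫ +-congˡ-≈ q (*-congˡ-≈ (- q) (*-congˡ-≈ v (*-congˡ-≈ (+ 2) l≈l₀) ⟫ unit))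
    ⟫ ≈-reflexive (lemma₆ q)

-- Squares modulo powers of 11

-- Last digit and quotient are separate arguments, so that a proof can split on the digit while
-- holding an equation for y modulo 11.
digit : (b g : ℕ → Bool) → ℕ → ℕ → Bool
digit b g zero      j = g j
digit b g r@(suc _) j = b r

step : (b g : ℕ → Bool) → ℕ → Bool
step b g y = digit b g (y ℕ.% 11) (y ℕ./ 11)

nonresidue : ℕ → Bool
nonresidue 2  = true
nonresidue 6  = true
nonresidue 7  = true
nonresidue 8  = true
nonresidue 10 = true
nonresidue _  = false

none : ℕ → Bool
none _ = false

-- For U ≡ 6 mod 11, evenPart α y decides whether U y is a square modulo 11^α, and
-- oddPart α y whether it is 11 times a square.
mutual
  evenPart : ℕ → ℕ → Bool
  -- Modulo 11^0 = 1 everything is a square.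
  evenPart zero    = λ _ → true
  evenPart (suc α) = step nonresidue (oddPart α)

  oddPart : ℕ → ℕ → Bool
  oddPart zero    = λ _ → true
  oddPart (suc α) = step none (evenPart α)

abstract
  -- Since 6 is a non-residue, 6 r is a nonzero square exactly for non-residues r. Only one
  -- direction is tabulated here; explicit roots give the other.
  square-table : ∀ (r s : Fin 11) → (toℕ s ℕ.* toℕ s) ℕ.% 11 ≡ (6 ℕ.* toℕ r) ℕ.% 11 →
    toℕ r ≡ 0 ⊎ nonresidue (toℕ r) ≡ true
  square-table = from-yes (all? {n = 11} λ r → all? {n = 11} λ s →
    ((toℕ s ℕ.* toℕ s) ℕ.% 11 ℕ.≟ (6 ℕ.* toℕ r) ℕ.% 11)
      →-dec ((toℕ r ℕ.≟ 0) ⊎-dec (nonresidue (toℕ r) Bool.≟ true)))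

  zero-table : ∀ (s : Fin 11) → (toℕ s ℕ.* toℕ s) ℕ.% 11 ≡ 0 → toℕ s ≡ 0
  zero-table = from-yes (all? {n = 11} λ s → ((toℕ s ℕ.* toℕ s) ℕ.% 11 ℕ.≟ 0) →-dec (toℕ s ℕ.≟ 0))

  six-table : ∀ (s : Fin 11) → (6 ℕ.* toℕ s) ℕ.% 11 ≡ 0 → toℕ s ≡ 0
  six-table = from-yes (all? {n = 11} λ s → ((6 ℕ.* toℕ s) ℕ.% 11 ℕ.≟ 0) →-dec (toℕ s ℕ.≟ 0))

square-nonresidue : ∀ {l r} → r ℕ.< 11 → l * l ≈ + 6 * + r [mod + 11 ] → r ≡ 0 ⊎ nonresidue r ≡ true
square-nonresidue {l} {r} r<11 l²≈6r = subst (λ r → r ≡ 0 ⊎ nonresidue r ≡ true) (toℕ-fromℕ< r<11)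
  (square-table (fromℕ< r<11) (fromℕ< s<11) table-entry)
  where
  s = l %ℕ 11
  s<11 = n%ℕd<d l 11
  l≈s = remainder l 11
  table-entry : (toℕ (fromℕ< s<11) ℕ.* toℕ (fromℕ< s<11)) ℕ.% 11 ≡ (6 ℕ.* toℕ (fromℕ< r<11)) ℕ.% 11
  table-entry rewrite toℕ-fromℕ< s<11 | toℕ-fromℕ< r<11 = ≈⇒%≡ 11
    ( ≈-reflexive (ℤ.pos-* s s)
    ⟫ *-cong-≈ (≈-sym l≈s) (≈-sym l≈s)
    ⟫ l²≈6r
    ⟫ ≈-reflexive (sym (ℤ.pos-* 6 r)))

square-divisible : ∀ {l} → l * l ≈ 0ℤ [mod + 11 ] → l ≈ 0ℤ [mod + 11 ]
square-divisible {l} l²≈0 = l≈s ⟫ ≈-reflexive (cong +_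
  (trans (sym (toℕ-fromℕ< s<11)) (zero-table (fromℕ< s<11) table-entry)))
  where
  s = l %ℕ 11
  s<11 = n%ℕd<d l 11
  l≈s = remainder l 11
  table-entry : (toℕ (fromℕ< s<11) ℕ.* toℕ (fromℕ< s<11)) ℕ.% 11 ≡ 0
  table-entry rewrite toℕ-fromℕ< s<11 = ≈⇒%≡ 11 {b = 0}
    (≈-reflexive (ℤ.pos-* s s) ⟫ *-cong-≈ (≈-sym l≈s) (≈-sym l≈s) ⟫ l²≈0)

6r≈0⇒r≡0 : ∀ {r} → r ℕ.< 11 → + 6 * + r ≈ 0ℤ [mod + 11 ] → r ≡ 0
6r≈0⇒r≡0 {r} r<11 6r≈0 = trans (sym (toℕ-fromℕ< r<11)) (six-table (fromℕ< r<11) table-entry)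
  where
  table-entry : (6 ℕ.* toℕ (fromℕ< r<11)) ℕ.% 11 ≡ 0
  table-entry rewrite toℕ-fromℕ< r<11 = ≈⇒%≡ 11 {b = 0} (≈-reflexive (ℤ.pos-* 6 r) ⟫ 6r≈0)

-- Starting data for `sqrt-lift`: a root of 6 r and the inverse of its double.
nonresidue-root : ∀ r → nonresidue r ≡ true → ∃[ l ] ∃[ v ]
  l * l ≈ + 6 * + r [mod + 11 ] × v * (+ 2 * l) ≈ 1ℤ [mod + 11 ]
nonresidue-root 0  ()
nonresidue-root 1  ()
nonresidue-root 2  _ = + 1 , + 6 , by (- + 1) refl , by (+ 1) refl
nonresidue-root 3  ()
nonresidue-root 4  ()
nonresidue-root 5  ()
nonresidue-root 6  _ = + 5 , + 10 , by (- + 1) refl , by (+ 9) refl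
nonresidue-root 7  _ = + 3 , + 2 , by (- + 3) refl , by (+ 1) refl
nonresidue-root 8  _ = + 2 , + 3 , by (- + 4) refl , by (+ 1) refl
nonresidue-root 9  ()
nonresidue-root 10 _ = + 4 , + 7 , by (- + 4) refl , by (+ 5) refl
nonresidue-root (suc (suc (suc (suc (suc (suc (suc (suc (suc (suc (suc _))))))))))) ()

last-digit-0 : ∀ y → y ℕ.% 11 ≡ 0 → + y ≡ + 11 * + (y ℕ./ 11)
last-digit-0 y e = begin
  + y                                       ≡⟨ cong +_ (ℕ.m≡m%n+[m/n]*n y 11) ⟩
  + (y ℕ.% 11 ℕ.+ y ℕ./ 11 ℕ.* 11)          ≡⟨ cong (λ r → + (r ℕ.+ y ℕ./ 11 ℕ.* 11)) e ⟩
  + (y ℕ./ 11 ℕ.* 11)                       ≡⟨ cong +_ (ℕ.*-comm (y ℕ./ 11) 11) ⟩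
  + (11 ℕ.* (y ℕ./ 11))                     ≡⟨ ℤ.pos-* 11 (y ℕ./ 11) ⟩
  + 11 * + (y ℕ./ 11)                       ∎
  where open ≡-Reasoning

module _ {U : ℤ} (U≈6 : U ≈ + 6 [mod + 11 ]) where

  mod-11-digit : ∀ {y r} → y ℕ.% 11 ≡ r → U * + y ≈ + 6 * + r [mod + 11 ]
  mod-11-digit {y} refl = *-cong-≈ U≈6 (remainderℕ y 11)

  pull-11 : ∀ y → y ℕ.% 11 ≡ 0 → U * + y ≡ + 11 * (U * + (y ℕ./ 11))
  pull-11 y e = trans (cong (U *_) (last-digit-0 y e)) (lemma U (+ (y ℕ./ 11)))
    where
    lemma : ∀ U z → U * (+ 11 * z) ≡ + 11 * (U * z)
    lemma = solve-∀

  unscale-11 : ∀ α {y} → y ℕ.% 11 ≡ 0 → ∀ z → U * + y ≈ + 11 * z [mod P (suc α) ] →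
    U * + (y ℕ./ 11) ≈ z [mod P α ]
  unscale-11 α {y} e z h = ≈-unscale 11 {U * + (y ℕ./ 11)} {z} {P α}
    (mod-P-suc⁻ α (≈-reflexive (sym (pull-11 y e)) ⟫ h))

  scale-11 : ∀ α {y} → y ℕ.% 11 ≡ 0 → ∀ z → U * + (y ℕ./ 11) ≈ z [mod P α ] →
    U * + y ≈ + 11 * z [mod P (suc α) ]
  scale-11 α {y} e z h = mod-P-suc α (≈-reflexive (pull-11 y e) ⟫ ≈-scale (+ 11) h)

  square-11 : ∀ k → (0ℤ + k * + 11) * (0ℤ + k * + 11) ≡ + 11 * (+ 11 * (k * k))
  square-11 = solve-∀

  square-11′ : ∀ l → + 11 * (+ 11 * (l * l)) ≡ + 11 * l * (+ 11 * l)
  square-11′ = solve-∀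

  mutual
    -- Descent on base-11 digits. If 11 divides y, it divides l = 11 k, and dividing U y ≡ 121 k² by
    -- 11 leaves 11 times a square one level lower. A nonzero last digit r makes 6 r a nonzero
    -- square.
    evenPart-sound : ∀ α y l → U * + y ≈ l * l [mod P α ] → evenPart α y ≡ true
    evenPart-sound zero    y l Uy≈l² = refl
    evenPart-sound (suc α) y l Uy≈l² = evenDigit-sound α y l Uy≈l² (y ℕ.% 11) refl

    evenDigit-sound : ∀ α y l → U * + y ≈ l * l [mod P (suc α) ] →
      ∀ r → y ℕ.% 11 ≡ r → digit nonresidue (oddPart α) r (y ℕ./ 11) ≡ true
    evenDigit-sound α y l Uy≈l² zero e =
      oddPart-sound α (y ℕ./ 11) k
        (unscale-11 α {y} e (+ 11 * (k * k)) (Uy≈l² ⟫ ≈-reflexive l²≡))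
      where
      11∣l : l ≈ 0ℤ [mod + 11 ]
      11∣l = square-divisible {l} (≈-sym (mod-11 α Uy≈l²) ⟫ mod-11-digit {y} e)
      k = _≈_[mod_].quotient 11∣l
      l²≡ : l * l ≡ + 11 * (+ 11 * (k * k))
      l²≡ = trans (cong₂ _*_ (_≈_[mod_].equality 11∣l) (_≈_[mod_].equality 11∣l)) (square-11 k)
    evenDigit-sound α y l Uy≈l² (suc r) e =
      [ (λ ()) , (λ nr → nr) ]′
        (square-nonresidue {l} {suc r} (subst (ℕ._< 11) e (ℕ.m%n<n y 11))
          (≈-sym (mod-11 α Uy≈l²) ⟫ mod-11-digit {y} e))

    oddPart-sound : ∀ α y l → U * + y ≈ + 11 * (l * l) [mod P α ] → oddPart α y ≡ true
    oddPart-sound zero    y l Uy≈11l² = refl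
    oddPart-sound (suc α) y l Uy≈11l² = oddDigit-sound α y l Uy≈11l² (y ℕ.% 11) refl

    oddDigit-sound : ∀ α y l → U * + y ≈ + 11 * (l * l) [mod P (suc α) ] →
      ∀ r → y ℕ.% 11 ≡ r → digit none (evenPart α) r (y ℕ./ 11) ≡ true
    oddDigit-sound α y l Uy≈11l² zero    e = evenPart-sound α (y ℕ./ 11) l (unscale-11 α {y} e (l * l) Uy≈11l²)
    -- Here 11 would divide U y, although U and the last digit of y are units.
    oddDigit-sound α y l Uy≈11l² (suc r) e = contradiction (6r≈0⇒r≡0 (subst (ℕ._< 11) e (ℕ.m%n<n y 11))
      ( ≈-sym (mod-11-digit {y} e)
      ⟫ mod-11 α Uy≈11l²
      ⟫ by (l * l) (trans (ℤ.*-comm (+ 11) (l * l)) (sym (ℤ.+-identityˡ (l * l * + 11)))))) λ ()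

  mutual
    evenPart-complete : ∀ α y → evenPart α y ≡ true → ∃[ l ] U * + y ≈ l * l [mod P α ]
    evenPart-complete zero    y _ = 0ℤ , by (U * + y) (lemma (U * + y))
      where
      lemma : ∀ z → z ≡ 0ℤ * 0ℤ + z * 1ℤ
      lemma = solve-∀
    evenPart-complete (suc α) y h = evenDigit-complete α y (y ℕ.% 11) refl h

    evenDigit-complete : ∀ α y r → y ℕ.% 11 ≡ r → digit nonresidue (oddPart α) r (y ℕ./ 11) ≡ true →
      ∃[ l ] U * + y ≈ l * l [mod P (suc α) ]
    evenDigit-complete α y zero e h
      with l , Uy′≈ ← oddPart-complete α (y ℕ./ 11) h
      -- From U (y / 11) ≡ 11 l² follows U y ≡ (11 l)² one level higher.
      = + 11 * l , (scale-11 α {y} e (+ 11 * (l * l)) Uy′≈ ⟫ ≈-reflexive (square-11′ l))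
    evenDigit-complete α y (suc r) e h
      with l₀ , v , root , unit ← nonresidue-root (suc r) h
      with l , l²≈ , _ ← sqrt-lift l₀ v unit (root ⟫ ≈-sym (mod-11-digit {y} e)) α
      = l , ≈-sym l²≈

    oddPart-complete : ∀ α y → oddPart α y ≡ true → ∃[ l ] U * + y ≈ + 11 * (l * l) [mod P α ]
    oddPart-complete zero    y _ = 0ℤ , by (U * + y) (lemma (U * + y))
      where
      lemma : ∀ z → z ≡ + 11 * (0ℤ * 0ℤ) + z * 1ℤ
      lemma = solve-∀
    oddPart-complete (suc α) y h = oddDigit-complete α y (y ℕ.% 11) refl h

    oddDigit-complete : ∀ α y r → y ℕ.% 11 ≡ r → digit none (evenPart α) r (y ℕ./ 11) ≡ true →
      ∃[ l ] U * + y ≈ + 11 * (l * l) [mod P (suc α) ]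
    -- Nonzero digits are excluded by `none`.
    oddDigit-complete α y zero e h
      with l , Uy′≈ ← evenPart-complete α (y ℕ./ 11) h
      = l , scale-11 α {y} e (l * l) Uy′≈

-- Residues of the Fibonacci sequence

-- The residues F i + 6 mod 11 for i ≢ 5 mod 10; adding 6 ≡ − C moves the centre C to 0.
regular : ℕ → Bool
regular 3 = true
regular 5 = true
regular 6 = true
regular 7 = true
regular 8 = true
regular 9 = true
regular _ = false

-- Starting data for `surjective`: the first index in the residue class and the inverse of its
-- slope.
regular-index : ∀ r → regular r ≡ true → ∃[ i ] ∃[ v ]
  fib i ≈ + r - + 6 [mod + 11 ] × v * (+ 3 * fib i + + 5 * fib (suc i)) ≈ 1ℤ [mod + 11 ]
regular-index 0  ()
regular-index 1  ()
regular-index 2  ()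
regular-index 3  _ = 6 , + 1 , by (+ 1) refl , by (+ 8) refl
regular-index 4  ()
regular-index 5  _ = 8 , + 6 , by (+ 2) refl , by (+ 127) refl
regular-index 6  _ = 0 , + 9 , by (+ 0) refl , by (+ 4) refl
regular-index 7  _ = 1 , + 7 , by (+ 0) refl , by (+ 5) refl
regular-index 8  _ = 3 , + 10 , by (+ 0) refl , by (+ 19) refl
regular-index 9  _ = 4 , + 1 , by (+ 0) refl , by (+ 3) refl
regular-index (suc (suc (suc (suc (suc (suc (suc (suc (suc (suc _)))))))))) ()

-- A check over one period modulo 11. The form `suc d` matters because `digit` consults `regular` at
-- nonzero digits only.
regular-or-5 : ∀ r → r ℕ.< 10 →
  r ≡ 5 ⊎ ∃[ d ] (F r ℕ.+ 6) ℕ.% 11 ≡ suc d × regular (suc d) ≡ true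
regular-or-5 0 _ = inj₂ (_ , refl , refl)
regular-or-5 1 _ = inj₂ (_ , refl , refl)
regular-or-5 2 _ = inj₂ (_ , refl , refl)
regular-or-5 3 _ = inj₂ (_ , refl , refl)
regular-or-5 4 _ = inj₂ (_ , refl , refl)
regular-or-5 5 _ = inj₁ refl
regular-or-5 6 _ = inj₂ (_ , refl , refl)
regular-or-5 7 _ = inj₂ (_ , refl , refl)
regular-or-5 8 _ = inj₂ (_ , refl , refl)
regular-or-5 9 _ = inj₂ (_ , refl , refl)
regular-or-5 (suc (suc (suc (suc (suc (suc (suc (suc (suc (suc r)))))))))) r<10 =
  contradiction r<10 (ℕ.m+n≮m 10 r)

-- Classes with nonzero last digit are attained entirely or not at all. At last digit 0 the test
-- coincides with `evenPart`, both deferring to `oddPart`; this is how the square criterion enters.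
member : ℕ → ℕ → Bool
member zero    = λ _ → true
member (suc α) = step regular (oddPart α)

digit-zero : ∀ b b′ g {r} j → r ≡ 0 → digit b g r j ≡ digit b′ g r j
digit-zero b b′ g j refl = refl

digit-suc : ∀ b g {r} d j → r ≡ suc d → digit b g r j ≡ b (suc d)
digit-suc b g d j refl = refl

module Centre (α : ℕ) where

  private
    instance
      11^α≢0 : NonZero (11 ^ suc α)
      11^α≢0 = ℕ.m^n≢0 11 (suc α)

  M = P (suc α)

  abstract
    -- By `conic`, a zero of 5 x² - 4 modulo `M` is a Fibonacci number whose Lucas companion
    -- vanishes modulo `M`.
    critical : ∃[ k ] luc (k ℕ.* 10 ℕ.+ 5) ≈ 0ℤ [mod M ]
    critical = surjective-luc ≈-refl α

  C : ℤ
  C = fib (proj₁ critical ℕ.* 10 ℕ.+ 5)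

  C≈5 : C ≈ + 5 [mod + 11 ]
  C≈5 = periodic-mod-11 fib fib-like (proj₁ critical) 5

  5C²≈4 : + 5 * (C * C) ≈ + 4 [mod M ]
  5C²≈4 = ≈-difference
    (≈-reflexive (sym (conic (proj₁ critical))) ⟫ *-cong-≈ (proj₂ critical) (proj₂ critical))

  abstract
    -- A natural representative of -C, so that y = x - C stays in ℕ, where digits are defined.
    shift : ℕ
    shift = (- C) %ℕ (11 ^ suc α)

    shift≈-C : + shift ≈ - C [mod M ]
    shift≈-C = ≈-sym (remainder (- C) (11 ^ suc α))

  shift≈6 : + shift ≈ + 6 [mod + 11 ]
  shift≈6 = mod-11 α shift≈-C ⟫ neg-cong-≈ C≈5 ⟫ by (- 1ℤ) refl

  -- The cofactor of y = x - C in 5 x² - 4 modulo `M`. If 11 divides y it is ≡ 5 · 2 · 5 = 50 ≡ 6,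
  -- the unit U of the square criterion.
  factor : ℕ → ℤ
  factor y = + 5 * (+ y + + 2 * C)

  factor≈6 : ∀ {y} → y ℕ.% 11 ≡ 0 → factor y ≈ + 6 [mod + 11 ]
  factor≈6 {y} e =
    *-congˡ-≈ (+ 5) (+-cong-≈ (remainderℕ y 11 ⟫ ≈-reflexive (cong +_ e)) (*-congˡ-≈ (+ 2) C≈5))
    ⟫ by (+ 4) refl

  x≈y+C : ∀ x → + x ≈ + (shift ℕ.+ x) + C [mod M ]
  x≈y+C x = ≈-reflexive (lemma (+ x) C) ⟫ +-cong-≈ (+-cong-≈ (≈-sym shift≈-C) (≈-refl {+ x})) (≈-refl {C})
    where
    lemma : ∀ x C → x ≡ - C + x + C
    lemma = solve-∀

  factor-y≈ : ∀ x → factor (shift ℕ.+ x) * + (shift ℕ.+ x) ≈ + 5 * (+ x * + x) - + 4 [mod M ]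
  factor-y≈ x =
    ≈-reflexive (lemma (+ (shift ℕ.+ x)) C)
    ⟫ +-cong-≈ (*-congˡ-≈ (+ 5) (*-cong-≈ (≈-sym (x≈y+C x)) (≈-sym (x≈y+C x)))) (neg-cong-≈ 5C²≈4)
    where
    lemma : ∀ y C → + 5 * (y + + 2 * C) * y ≡ + 5 * ((y + C) * (y + C)) - + 5 * (C * C)
    lemma = solve-∀

  y≈x+6 : ∀ x → + (shift ℕ.+ x) ≈ + x + + 6 [mod + 11 ]
  y≈x+6 x = +-cong-≈ shift≈6 (≈-refl {+ x}) ⟫ ≈-reflexive (ℤ.+-comm (+ 6) (+ x))

  -- For n ≢ 5 modulo 10, F n modulo 11 already lies in a regular class. For n ≡ 5 the conic gives
  -- `factor y` · y ≡ (L n)², so the square criterion applies with root L n.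
  member-sound : ∀ n x → fib n ≈ + x [mod M ] → member (suc α) (shift ℕ.+ x) ≡ true
  member-sound n x Fn≈x = [ singular , nonsingular ]′ (regular-or-5 r (ℕ.m%n<n n 10))
    where
    r = n ℕ.% 10
    k = n ℕ./ 10
    y = shift ℕ.+ x
    n≡ : n ≡ k ℕ.* 10 ℕ.+ r
    n≡ = trans (ℕ.m≡m%n+[m/n]*n n 10) (ℕ.+-comm r (k ℕ.* 10))

    y%11 : y ℕ.% 11 ≡ (F r ℕ.+ 6) ℕ.% 11
    y%11 = ≈⇒%≡ 11
      ( y≈x+6 x
      ⟫ +-cong-≈ (≈-sym (mod-11 α Fn≈x) ⟫ ≈-reflexive (cong fib n≡) ⟫ periodic-mod-11 fib fib-like k r)
                 (≈-refl {+ 6}))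

    nonsingular : ∃[ d ] (F r ℕ.+ 6) ℕ.% 11 ≡ suc d × regular (suc d) ≡ true → member (suc α) y ≡ true
    nonsingular (d , e , reg) = trans (digit-suc regular (oddPart α) d (y ℕ./ 11) (trans y%11 e)) reg

    singular : r ≡ 5 → member (suc α) y ≡ true
    singular r≡5 = trans (digit-zero regular nonresidue (oddPart α) (y ℕ./ 11) y%11≡0)
      (evenPart-sound (factor≈6 y%11≡0) (suc α) y (luc (k ℕ.* 10 ℕ.+ 5))
        ( factor-y≈ x
        ⟫ +-cong-≈ (*-congˡ-≈ (+ 5) (*-cong-≈ x≈F x≈F)) (≈-refl { - + 4})
        ⟫ ≈-reflexive (sym (conic k))))
      where
      y%11≡0 : y ℕ.% 11 ≡ 0
      y%11≡0 = trans y%11 (cong (λ r → (F r ℕ.+ 6) ℕ.% 11) r≡5)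
      x≈F : + x ≈ fib (k ℕ.* 10 ℕ.+ 5) [mod M ]
      x≈F = ≈-sym Fn≈x ⟫ ≈-reflexive (cong fib (trans n≡ (cong (k ℕ.* 10 ℕ.+_) r≡5)))

  -- Modulo 11^α a point x of the conic 5 x² − 4 = l² is determined by l, since
  -- x ≡ 5 mod 11 makes F n + x a unit.
  conic-unique : ∀ k x → + x ≈ + 5 [mod + 11 ] →
    luc (k ℕ.* 10 ℕ.+ 5) * luc (k ℕ.* 10 ℕ.+ 5) ≈ + 5 * (+ x * + x) - + 4 [mod M ] →
    fib (k ℕ.* 10 ℕ.+ 5) ≈ + x [mod M ]
  conic-unique k x x≈5 L²≈ = ≈-difference (unit-cancel (+ 5 * (f + + x)) (+ 2)
    -- Modulo 11 the factor 5 (f + x) is 5 · (5 + 5) = 50, and 2 · 50 = 1 + 9 · 11.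
    (*-congˡ-≈ (+ 2) (*-congˡ-≈ (+ 5) (+-cong-≈ (periodic-mod-11 fib fib-like k 5) x≈5)) ⟫ by (+ 9) refl)
    (suc α)
    ( ≈-reflexive (lemma₁ f (+ x))
    ⟫ +-cong-≈ (≈-reflexive (sym (conic k)) ⟫ L²≈) (≈-refl { - (+ 5 * (+ x * + x) - + 4)})
    ⟫ ≈-reflexive (lemma₂ (+ 5 * (+ x * + x) - + 4))))
    where
    f = fib (k ℕ.* 10 ℕ.+ 5)
    lemma₁ : ∀ f x → + 5 * (f + x) * (f - x) ≡ + 5 * (f * f) - + 4 - (+ 5 * (x * x) - + 4)
    lemma₁ = solve-∀
    lemma₂ : ∀ z → z - z ≡ 0ℤ
    lemma₂ = solve-∀

  x≈y-6 : ∀ x {r} → (shift ℕ.+ x) ℕ.% 11 ≡ r → + x ≈ + r - + 6 [mod + 11 ]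
  x≈y-6 x e = ≈-reflexive (lemma (+ x))
    ⟫ +-cong-≈ (≈-sym (y≈x+6 x) ⟫ remainderℕ (shift ℕ.+ x) 11 ⟫ ≈-reflexive (cong +_ e)) (≈-refl { - + 6})
    where
    lemma : ∀ x → x ≡ x + + 6 - + 6
    lemma = solve-∀

  -- At last digit 0 the criterion yields l with l² ≡ 5 x² - 4 and 11 ∣ l; some L n hits l, and
  -- `conic-unique` forces F n ≡ x. At other digits `surjective` lifts a solution modulo 11.
  member-complete : ∀ x → member (suc α) (shift ℕ.+ x) ≡ true → ∃[ n ] fib n ≈ + x [mod M ]
  member-complete x = by-digit (y ℕ.% 11) refl
    where
    y = shift ℕ.+ x
    by-digit : ∀ r → y ℕ.% 11 ≡ r → digit regular (oddPart α) r (y ℕ./ 11) ≡ true →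
      ∃[ n ] fib n ≈ + x [mod M ]
    by-digit zero e h = from-root
      (evenPart-complete (factor≈6 e) (suc α) y
        (trans (trans (digit-zero nonresidue regular (oddPart α) (y ℕ./ 11) e)
                      (cong (λ r → digit regular (oddPart α) r (y ℕ./ 11)) e)) h))
      where
      from-root : ∃[ l ] factor y * + y ≈ l * l [mod M ] → ∃[ n ] fib n ≈ + x [mod M ]
      from-root (l , Uy≈l²) = from-index (surjective-luc (square-divisible l²≈0) α)
        where
        l²≈0 : l * l ≈ 0ℤ [mod + 11 ]
        l²≈0 = ≈-sym (mod-11 α Uy≈l²) ⟫ mod-11-digit (factor≈6 e) {y} e
        from-index : ∃[ k ] luc (k ℕ.* 10 ℕ.+ 5) ≈ l [mod M ] → ∃[ n ] fib n ≈ + x [mod M ]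
        from-index (k , L≈l) = k ℕ.* 10 ℕ.+ 5 , conic-unique k x (x≈y-6 x e ⟫ by (- 1ℤ) refl)
          (*-cong-≈ L≈l L≈l ⟫ ≈-sym Uy≈l² ⟫ factor-y≈ x)
    by-digit (suc r) e h = from-index (regular-index (suc r) h)
      where
      from-index : ∃[ i ] ∃[ v ] fib i ≈ + suc r - + 6 [mod + 11 ]
        × v * (+ 3 * fib i + + 5 * fib (suc i)) ≈ 1ℤ [mod + 11 ] → ∃[ n ] fib n ≈ + x [mod M ]
      from-index (i , v , Fi≈ , unit) =
        let k , Fn≈x = surjective fib fib-like i v unit (Fi≈ ⟫ ≈-sym (x≈y-6 x e)) α
        in k ℕ.* 10 ℕ.+ i , Fn≈x

-- Counting

indicator : Bool → ℕ
indicator b = if b then 1 else 0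

count : (ℕ → Bool) → ℕ → ℕ
count p zero    = 0
count p (suc m) = indicator (p 0) ℕ.+ count (p ∘ suc) m

∣tabulate∣ : ∀ p m → ∣ tabulate {n = m} (p ∘ toℕ) ∣ ≡ count p m
∣tabulate∣ p zero = refl
∣tabulate∣ p (suc m) with p 0
... | true  = cong suc (∣tabulate∣ (p ∘ suc) m)
... | false = ∣tabulate∣ (p ∘ suc) m

count-cong : ∀ {p q} → (∀ y → p y ≡ q y) → ∀ m → count p m ≡ count q m
count-cong p≗q zero    = refl
count-cong p≗q (suc m) = cong₂ ℕ._+_ (cong indicator (p≗q 0)) (count-cong (p≗q ∘ suc) m)

count-+ : ∀ p m n → count p (m ℕ.+ n) ≡ count p m ℕ.+ count (p ∘ (m ℕ.+_)) n
count-+ p zero    n = refl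
count-+ p (suc m) n = trans (cong (indicator (p 0) ℕ.+_) (count-+ (p ∘ suc) m n))
  (sym (ℕ.+-assoc (indicator (p 0)) _ _))

Periodic : ℕ → (ℕ → Bool) → Set
Periodic m p = ∀ y → p (m ℕ.+ y) ≡ p y

-- The windows 0 ... m-1 and 1 ... m each arise from 0 ... m by dropping one end, and p agrees at
-- both ends.
count-suc-periodic : ∀ {m p} → Periodic m p → count (p ∘ suc) m ≡ count p m
count-suc-periodic {m} {p} per = ℕ.+-cancelˡ-≡ (indicator (p 0)) _ _ (begin
  count p (1 ℕ.+ m)                                  ≡⟨ cong (count p) (ℕ.+-comm 1 m) ⟩
  count p (m ℕ.+ 1)                                  ≡⟨ count-+ p m 1 ⟩
  count p m ℕ.+ (indicator (p (m ℕ.+ 0)) ℕ.+ 0)      ≡⟨ cong (count p m ℕ.+_) (ℕ.+-identityʳ _) ⟩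
  count p m ℕ.+ indicator (p (m ℕ.+ 0))              ≡⟨ cong (λ b → count p m ℕ.+ indicator b) (per 0) ⟩
  count p m ℕ.+ indicator (p 0)                      ≡⟨ ℕ.+-comm (count p m) _ ⟩
  indicator (p 0) ℕ.+ count p m                      ∎)
  where open ≡-Reasoning

-- This makes the number of residues independent of the centre C.
count-shift : ∀ {m p} → Periodic m p → ∀ s → count (p ∘ (s ℕ.+_)) m ≡ count p m
count-shift per zero = refl
count-shift {m} {p} per (suc s) =
  trans (count-shift {m} {p ∘ suc} (λ y → trans (cong p (sym (ℕ.+-suc m y))) (per (suc y))) s)
        (count-suc-periodic per)

step-shift : ∀ b g m y → step b g (m ℕ.* 11 ℕ.+ y) ≡ step b (g ∘ (m ℕ.+_)) y
step-shift b g m y = trans (cong₂ (digit b g) %-shift /-shift) (digit-∘ (y ℕ.% 11))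
  where
  %-shift : (m ℕ.* 11 ℕ.+ y) ℕ.% 11 ≡ y ℕ.% 11
  %-shift = trans (cong (ℕ._% 11) (ℕ.+-comm (m ℕ.* 11) y)) (ℕ.[m+kn]%n≡m%n y m 11)
  /-shift : (m ℕ.* 11 ℕ.+ y) ℕ./ 11 ≡ m ℕ.+ y ℕ./ 11
  /-shift = trans (ℕ.+-distrib-/-∣ˡ y {11} (divides-refl m)) (cong (ℕ._+ y ℕ./ 11) (ℕ.m*n/n≡m m 11))
  digit-∘ : ∀ r → digit b g r (m ℕ.+ y ℕ./ 11) ≡ digit b (g ∘ (m ℕ.+_)) r (y ℕ./ 11)
  digit-∘ zero    = refl
  digit-∘ (suc r) = refl

step-cong : ∀ b {g h} → (∀ y → g y ≡ h y) → ∀ y → step b g y ≡ step b h y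
step-cong b {g} {h} g≗h y = digit-cong (y ℕ.% 11)
  where
  digit-cong : ∀ r → digit b g r (y ℕ./ 11) ≡ digit b h r (y ℕ./ 11)
  digit-cong zero    = g≗h (y ℕ./ 11)
  digit-cong (suc r) = refl

step-periodic : ∀ b {g m} → Periodic m g → Periodic (11 ℕ.* m) (step b g)
step-periodic b {g} {m} per y =
  trans (cong (λ k → step b g (k ℕ.+ y)) (ℕ.*-comm 11 m))
        (trans (step-shift b g m y) (step-cong b per y))

-- In each block of 11 consecutive numbers `b` decides the ten nonzero digits, and `g` at the block
-- number decides digit 0.
count-step : ∀ b g m → count (step b g) (m ℕ.* 11) ≡ m ℕ.* count (b ∘ suc) 10 ℕ.+ count g m
count-step b g zero    = refl
count-step b g (suc m) = begin
  count (step b g) (11 ℕ.+ m ℕ.* 11)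
    ≡⟨ count-+ (step b g) 11 (m ℕ.* 11) ⟩
  (g₀ ℕ.+ c) ℕ.+ count (step b g ∘ (11 ℕ.+_)) (m ℕ.* 11)
    ≡⟨ cong (λ k → (g₀ ℕ.+ c) ℕ.+ k)
         (trans (count-cong (step-shift b g 1) (m ℕ.* 11)) (count-step b (g ∘ suc) m)) ⟩
  (g₀ ℕ.+ c) ℕ.+ (m ℕ.* c ℕ.+ count (g ∘ suc) m)
    ≡⟨ lemma g₀ c (m ℕ.* c) (count (g ∘ suc) m) ⟩
  (c ℕ.+ m ℕ.* c) ℕ.+ (g₀ ℕ.+ count (g ∘ suc) m) ∎
  where
  open ≡-Reasoning
  c = count (b ∘ suc) 10
  g₀ = indicator (g 0)
  lemma : ∀ g c u v → (g ℕ.+ c) ℕ.+ (u ℕ.+ v) ≡ (c ℕ.+ u) ℕ.+ (g ℕ.+ v)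
  lemma = ℕ.solve-∀

count-step-^ : ∀ b g α → count (step b g) (11 ^ suc α) ≡ 11 ^ α ℕ.* count (b ∘ suc) 10 ℕ.+ count g (11 ^ α)
count-step-^ b g α = trans (cong (count (step b g)) (ℕ.*-comm 11 (11 ^ α))) (count-step b g (11 ^ α))

mutual
  evenPart-periodic : ∀ α → Periodic (11 ^ α) (evenPart α)
  evenPart-periodic zero    y = refl
  evenPart-periodic (suc α) = step-periodic nonresidue (oddPart-periodic α)

  oddPart-periodic : ∀ α → Periodic (11 ^ α) (oddPart α)
  oddPart-periodic zero    y = refl
  oddPart-periodic (suc α) = step-periodic none (evenPart-periodic α)

-- Two levels give N (α+2) = 5 · 11^α + N α. As 24 · 5 = 11² - 1, the difference 24 N α - 11^α is
-- unchanged, so it only takes its two initial values 23 and 13.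
count-oddPart : ∀ α → ∃[ c ] 24 ℕ.* count (oddPart α) (11 ^ α) ≡ 11 ^ α ℕ.+ c × c ℕ.< 24
count-oddPart zero          = 23 , refl , ℕ.≤-refl
count-oddPart (suc zero)    = 13 , refl , ℕ.m≤m+n 14 10
count-oddPart (suc (suc α)) with c , eq , c<24 ← count-oddPart α = c , (begin
  24 ℕ.* count (oddPart (2 ℕ.+ α)) (11 ^ (2 ℕ.+ α))
    ≡⟨ cong (24 ℕ.*_) (trans (count-step-^ none (evenPart (suc α)) (suc α))
         (cong (11 ^ suc α ℕ.* 0 ℕ.+_) (count-step-^ nonresidue (oddPart α) α))) ⟩
  24 ℕ.* (11 ^ suc α ℕ.* 0 ℕ.+ (11 ^ α ℕ.* 5 ℕ.+ count (oddPart α) (11 ^ α)))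
    ≡⟨ lemma₁ (11 ^ suc α) (11 ^ α) (count (oddPart α) (11 ^ α)) ⟩
  120 ℕ.* 11 ^ α ℕ.+ 24 ℕ.* count (oddPart α) (11 ^ α)
    ≡⟨ cong (120 ℕ.* 11 ^ α ℕ.+_) eq ⟩
  120 ℕ.* 11 ^ α ℕ.+ (11 ^ α ℕ.+ c)
    ≡⟨ lemma₂ (11 ^ α) c ⟩
  11 ℕ.* (11 ℕ.* 11 ^ α) ℕ.+ c ∎) , c<24
  where
  open ≡-Reasoning
  lemma₁ : ∀ q p k → 24 ℕ.* (q ℕ.* 0 ℕ.+ (p ℕ.* 5 ℕ.+ k)) ≡ 120 ℕ.* p ℕ.+ 24 ℕ.* k
  lemma₁ = ℕ.solve-∀
  lemma₂ : ∀ p c → 120 ℕ.* p ℕ.+ (p ℕ.+ c) ≡ 11 ℕ.* (11 ℕ.* p) ℕ.+ c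
  lemma₂ = ℕ.solve-∀

-- Six full classes plus the odd part: 264 · 6 + 11 = 145 · 11, and the error is 11 times that of
-- `count-oddPart`.
count-member : ∀ α → ∃[ e ] 264 ℕ.* count (member (suc α)) (11 ^ suc α) ≡ 145 ℕ.* 11 ^ suc α ℕ.+ e
  × e ℕ.< 264
count-member α with c , eq , c<24 ← count-oddPart α = 11 ℕ.* c , (begin
  264 ℕ.* count (member (suc α)) (11 ^ suc α)
    ≡⟨ cong (264 ℕ.*_) (count-step-^ regular (oddPart α) α) ⟩
  264 ℕ.* (11 ^ α ℕ.* 6 ℕ.+ count (oddPart α) (11 ^ α))
    ≡⟨ lemma₁ (11 ^ α) (count (oddPart α) (11 ^ α)) ⟩
  1584 ℕ.* 11 ^ α ℕ.+ 11 ℕ.* (24 ℕ.* count (oddPart α) (11 ^ α))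
    ≡⟨ cong (λ k → 1584 ℕ.* 11 ^ α ℕ.+ 11 ℕ.* k) eq ⟩
  1584 ℕ.* 11 ^ α ℕ.+ 11 ℕ.* (11 ^ α ℕ.+ c)
    ≡⟨ lemma₂ (11 ^ α) c ⟩
  145 ℕ.* (11 ℕ.* 11 ^ α) ℕ.+ 11 ℕ.* c ∎) , ℕ.*-monoʳ-< 11 c<24
  where
  open ≡-Reasoning
  lemma₁ : ∀ p k → 264 ℕ.* (p ℕ.* 6 ℕ.+ k) ≡ 1584 ℕ.* p ℕ.+ 11 ℕ.* (24 ℕ.* k)
  lemma₁ = ℕ.solve-∀
  lemma₂ : ∀ p c → 1584 ℕ.* p ℕ.+ 11 ℕ.* (p ℕ.+ c) ≡ 145 ℕ.* (11 ℕ.* p) ℕ.+ 11 ℕ.* c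
  lemma₂ = ℕ.solve-∀

-- The limit

n<11^n : ∀ n → n ℕ.< 11 ^ n
n<11^n zero    = ℕ.≤-refl
n<11^n (suc n) = ℕ.≤-trans (ℕ.+-mono-≤ (ℕ.m^n>0 11 n) (n<11^n n))
  (ℕ.+-monoʳ-≤ (11 ^ n) (ℕ.m≤m+n (11 ^ n) (9 ℕ.* 11 ^ n)))

-- The difference is exactly e / (m b) < 1 / m, and 1 / m is at most the reciprocal of the
-- denominator of ε, hence at most ε.
close : ∀ m a b .{{_ : NonZero m}} .{{_ : NonZero b}} c e → b ℕ.* c ≡ a ℕ.* m ℕ.+ e → e ℕ.< b →
  ∀ ε → 0ℚ ℚ.< ε → ℚ.↧ₙ ε ℕ.≤ m → ℚ.∣ (+ c / m) ℚ.- (+ a / b) ∣ ℚ.< ε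
close m a b c e eq e<b (mkℚ (+ 0) d _) 0<ε d<m with () ← positive 0<ε
close m a b c e eq e<b (mkℚ ℤ.-[1+ _ ] d _) 0<ε d<m with () ← positive 0<ε
close m@(suc m-1) a b@(suc b-1) c e eq e<b (mkℚ ℤ.+[1+ n ] d _) 0<ε d<m =
  ℚ.toℚᵘ-cancel-< (ℚᵘ.<-respˡ-≃ (ℚᵘ.≃-sym difference) (*<* (subst₂ ℤ._<_
    (ℤ.pos-* e (suc d)) (ℤ.pos-* (suc n) (m ℕ.* b)) (+<+ bound))))
  where
  numerator : + c ℤ.* + b ℤ.+ (ℤ.- + a) ℤ.* + m ≡ + e
  numerator = trans (cong (λ z → z ℤ.+ (ℤ.- + a) ℤ.* + m) cb≡am+e) (cancel (+ a) (+ m) (+ e))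
    where
    cb≡am+e : + c ℤ.* + b ≡ + a ℤ.* + m ℤ.+ + e
    cb≡am+e = trans (sym (ℤ.pos-* c b)) (trans (cong +_ (trans (ℕ.*-comm c b) eq))
      (cong (ℤ._+ + e) (ℤ.pos-* a m)))
    cancel : ∀ a m e → a ℤ.* m ℤ.+ e ℤ.+ (ℤ.- a) ℤ.* m ≡ e
    cancel = solve-∀

  -- Unnormalised fractions keep the denominator m b without cancellation.
  difference : toℚᵘ ℚ.∣ (+ c / m) ℚ.- (+ a / b) ∣ ℚᵘ.≃ mkℚᵘ (+ e) (ℕ.pred (m ℕ.* b))
  difference = begin
    toℚᵘ ℚ.∣ p ℚ.- q ∣
      ≈⟨ ℚ.toℚᵘ-homo-∣-∣ (p ℚ.- q) ⟩
    ℚᵘ.∣ toℚᵘ (p ℚ.- q) ∣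
      ≈⟨ ℚᵘ.∣-∣-cong {toℚᵘ (p ℚ.- q)} {toℚᵘ p ℚᵘ.- toℚᵘ q}
           (ℚᵘ.≃-trans (ℚ.toℚᵘ-homo-+ p (ℚ.- q)) (ℚᵘ.+-congʳ (toℚᵘ p) (ℚ.toℚᵘ-homo‿- q))) ⟩
    ℚᵘ.∣ toℚᵘ p ℚᵘ.- toℚᵘ q ∣
      ≈⟨ ℚᵘ.∣-∣-cong {toℚᵘ p ℚᵘ.- toℚᵘ q} {pᵘ ℚᵘ.- qᵘ}
           (ℚᵘ.+-cong (ℚ.toℚᵘ-fromℚᵘ pᵘ) (ℚᵘ.-‿cong (ℚ.toℚᵘ-fromℚᵘ qᵘ))) ⟩
    ℚᵘ.∣ pᵘ ℚᵘ.- qᵘ ∣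
      ≡⟨ cong (λ z → mkℚᵘ (+ ℤ.∣ z ∣) (ℕ.pred (m ℕ.* b))) numerator ⟩
    mkℚᵘ (+ e) (ℕ.pred (m ℕ.* b)) ∎
    where
    open import Relation.Binary.Reasoning.Setoid ℚᵘ.≃-setoid
    p = + c / m
    q = + a / b
    pᵘ = mkℚᵘ (+ c) m-1
    qᵘ = mkℚᵘ (+ a) b-1

  bound : e ℕ.* suc d ℕ.< suc n ℕ.* (m ℕ.* b)
  bound = begin-strict
    e ℕ.* suc d              <⟨ ℕ.*-monoˡ-< (suc d) e<b ⟩
    b ℕ.* suc d              ≤⟨ ℕ.*-monoʳ-≤ b d<m ⟩
    b ℕ.* m                  ≡⟨ ℕ.*-comm b m ⟩
    m ℕ.* b                  ≤⟨ ℕ.m≤n*m (m ℕ.* b) (suc n) ⟩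
    suc n ℕ.* (m ℕ.* b)      ∎
    where open ℕ.≤-Reasoning

-- `Centre α` concerns the exponent `suc α`; modulo 1 the only residue is attained.
residue? : (α : ℕ) → ℕ → Bool
residue? zero    x = true
residue? (suc α) x = member (suc α) (Centre.shift α ℕ.+ x)

residueSet : (α : ℕ) → Subset (11 ^ α)
residueSet α = tabulate (residue? α ∘ toℕ)

∈-tabulate : ∀ {m} (p : ℕ → Bool) (r : Fin m) → r ∈ tabulate (p ∘ toℕ) ⇔ p (toℕ r) ≡ true
∈-tabulate p r = mk⇔
  (λ r∈ → trans (sym (lookup∘tabulate (p ∘ toℕ) r)) ([]=⇒lookup r∈))
  (λ pr → lookup⇒[]= r _ (trans (lookup∘tabulate (p ∘ toℕ) r) pr))

mod⇒≈ : ∀ m .{{_ : NonZero m}} n (r : Fin m) → n ℕ.mod m ≡ r → + n ≈ + toℕ r [mod + m ]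
mod⇒≈ m n r refl = remainderℕ n m ⟫ ≈-reflexive (cong +_ (sym (toℕ-fromℕ< (ℕ.m%n<n n m))))

≈⇒mod : ∀ m .{{_ : NonZero m}} n (r : Fin m) → + n ≈ + toℕ r [mod + m ] → n ℕ.mod m ≡ r
≈⇒mod m n r n≈r = toℕ-injective (trans (toℕ-fromℕ< (ℕ.m%n<n n m))
  (trans (≈⇒%≡ m n≈r) (ℕ.m<n⇒m%n≡m (toℕ<n r))))

residueSet-correct : ∀ α → IsResidueSet F (11 ^ α) {{m^n≢0 11 α}} (residueSet α)
residueSet-correct zero    Fin.zero = mk⇔ (λ _ → 0 , refl)
  (λ _ → Equivalence.from (∈-tabulate (residue? 0) Fin.zero) refl)
residueSet-correct (suc α) r = mk⇔
  (λ r∈ → let n , Fn≈r = member-complete (toℕ r) (Equivalence.to r∈⇔ r∈)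
          in n , ≈⇒mod (11 ^ suc α) {{m^n≢0 11 (suc α)}} (F n) r Fn≈r)
  (λ (n , Fn≡r) → Equivalence.from r∈⇔ (member-sound n (toℕ r)
    (mod⇒≈ (11 ^ suc α) {{m^n≢0 11 (suc α)}} (F n) r Fn≡r)))
  where
  open Centre α
  r∈⇔ : r ∈ residueSet (suc α) ⇔ residue? (suc α) (toℕ r) ≡ true
  r∈⇔ = ∈-tabulate (residue? (suc α)) r

∣residueSet∣ : ∀ α → ∣ residueSet (suc α) ∣ ≡ count (member (suc α)) (11 ^ suc α)
∣residueSet∣ α = trans (∣tabulate∣ (residue? (suc α)) (11 ^ suc α))
  (count-shift {11 ^ suc α} {member (suc α)} (step-periodic regular (oddPart-periodic α)) (Centre.shift α))

density-limit : Limit (λ α → density (11 ^ α) {{m^n≢0 11 α}} (residueSet α)) (+ 145 / 264)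
-- The successor rules out exponent 0; beyond it 11^α > α exceeds the denominator of ε.
density-limit ε 0<ε = suc (ℚ.↧ₙ ε) , λ where
  (suc α) N≤α →
    let e , eq , e<264 = count-member α in
    close (11 ^ suc α) 145 264 {{m^n≢0 11 (suc α)}} ∣ residueSet (suc α) ∣ e
      (trans (cong (264 ℕ.*_) (∣residueSet∣ α)) eq) e<264 ε 0<ε
      (ℕ.≤-trans (ℕ.n≤1+n _) (ℕ.≤-trans N≤α (ℕ.<⇒≤ (n<11^n (suc α)))))

theorem5p7 : Σ[ R ∈ ((α : ℕ) → Subset (11 ^ α)) ]
    ((α : ℕ) → IsResidueSet F (11 ^ α) {{m^n≢0 11 α}} (R α))
    × Limit (λ α → density (11 ^ α) {{m^n≢0 11 α}} (R α)) (+ 145 / 264)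
theorem5p7 = residueSet , residueSet-correct , density-limit
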